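{- Let $q$ be a prime power, let $m,n\ge 1$, and let $\mathcal{C}$ be a nondegenerate $[n,k,d]_{q^m/q}$ rank-metric intersecting code. Then $k\le d\le m$.
   Context: Support and rank: fix an $\mathbb{F}_q$-basis $\Gamma$ of $\mathbb{F}_{q^m}$. For $x=(x_1,\dots,x_n)\in\mathbb{F}_{q^m}^n$ let $\mathrm{Mat}_\Gamma(x)\in\mathbb{F}_q^{m\times n}$ be the matrix whose $j$-th column is the coordinate vector of $x_j$ in the basis $\Gamma$. The support $\sigma(x)\subseteq\mathbb{F}_q^n$ is the $\mathbb{F}_q$-row space of $\mathrm{Mat}_\Gamma(x)$, and $\mathrm{rk}(x)=\dim_{\mathbb{F}_q}\sigma(x)$; both are independent of $\Gamma$. An $[n,k,d]_{q^m/q}$ code is an $\mathbb{F}_{q^m}$-linear subspace $\mathcal{C}$ of $\mathbb{F}_{q^m}^n$ with $k=\dim_{\mathbb{F}_{q^m}}\mathcal{C}\ge 1$ and minimum distance $d=\min_{c\in\mathcal{C}\setminus\{0\}}\mathrm{rk}(c)$. The code is nondegenerate if $\sum_{c\in\mathcal{C}}\sigma(c)=\mathbb{F}_q^n$. It is rank-metric intersecting if $\sigma(c)\cap\sigma(c')\ne\{0\}$ for all $c,c'\in\mathcal{C}\setminus\{0\}$. -}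

module Defs where

open import Level using (Level; _⊔_; suc)
open import Algebra.Bundles using (Ring; CommutativeRing)
open import Algebra.Apartness.Bundles using (HeytingField; HeytingCommutativeRing)
open import Algebra.Module.Bundles using (LeftModule)
import Algebra.Module.Construct.TensorUnit as TensorUnit
import Algebra.Construct.Pointwise as Pointwise
import Algebra.Definitions.RawMonoid as RawMonoidDefs
open import Algebra.Morphism.Structures using (module RingMorphisms)
open import Data.Fin.Base using (Fin)
open import Data.Nat.Base using (ℕ; _^_; _≤_)
open import Data.Nat.Primality using (Prime)
open import Data.Product.Base using (∃; ∃₂; ∃-syntax; _×_; _,_; proj₁)
open import Data.Unit.Base using (tt)
open import Data.Vec.Functional using (Vector)
open import Function.Bundles using (Inverse)
open import Relation.Binary.Definitions using (_Respects_)
open import Relation.Binary.PropositionalEquality using (_≡_)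
import Relation.Binary.PropositionalEquality.Properties as ≡
open import Relation.Nullary.Negation using (¬_)
open import Relation.Unary using (Pred; _∈_; _∩_; _∖_; _≐_; _⊆_; U)

IsPrimePower : ℕ → Set
IsPrimePower q = ∃₂ λ p e → Prime p × 1 ≤ e × q ≡ p ^ e

IsMinimum : ∀ {ℓ} → Pred ℕ ℓ → Pred ℕ ℓ
IsMinimum P d = d ∈ P × (∀ {r} → r ∈ P → d ≤ r)

------------------------------------------------------------------------
-- Modules

-- The n-th power M ^ n, with componentwise equality and operations.
power : ∀ {r ℓr m ℓm} {R : Ring r ℓr} →
        LeftModule R m ℓm → ℕ → LeftModule R m ℓm
power {R = R} M n = record
  { Carrierᴹ = Vector Carrierᴹ n
  ; _≈ᴹ_     = λ x y → ∀ i → x i ≈ᴹ y i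
  ; _+ᴹ_     = λ x y i → x i +ᴹ y i
  ; _*ₗ_     = λ a x i → a *ₗ x i
  ; 0ᴹ       = λ _ → 0ᴹ
  ; -ᴹ_      = λ x i → -ᴹ x i
  ; isLeftModule = record
    { isLeftSemimodule = record
      { +ᴹ-isCommutativeMonoid =
          Pointwise.isCommutativeMonoid (Fin n) +ᴹ-isCommutativeMonoid
      ; isPreleftSemimodule = record
        { *ₗ-cong      = λ a≈b x≈y i → *ₗ-cong a≈b (x≈y i)
        ; *ₗ-zeroˡ     = λ x i → *ₗ-zeroˡ (x i)
        ; *ₗ-distribʳ  = λ x a b i → *ₗ-distribʳ (x i) a b
        ; *ₗ-identityˡ = λ x i → *ₗ-identityˡ (x i)
        ; *ₗ-assoc     = λ a b x i → *ₗ-assoc a b (x i)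
        ; *ₗ-zeroʳ     = λ a i → *ₗ-zeroʳ a
        ; *ₗ-distribˡ  = λ a x y i → *ₗ-distribˡ a (x i) (y i)
        }
      }
    ; -ᴹ‿cong    = λ x≈y i → -ᴹ‿cong (x≈y i)
    ; -ᴹ‿inverse = (λ x i → -ᴹ‿inverseˡ (x i)) , (λ x i → -ᴹ‿inverseʳ (x i))
    }
  }
  where open LeftModule M

-- Restriction of scalars along a ring homomorphism: a acts as f a.
restrictScalars : ∀ {r ℓr s ℓs m ℓm} {R : Ring r ℓr} {S : Ring s ℓs}
  (f : Ring.Carrier R → Ring.Carrier S) →
  RingMorphisms.IsRingHomomorphism (Ring.rawRing R) (Ring.rawRing S) f →
  LeftModule S m ℓm → LeftModule R m ℓm
restrictScalars {R = R} {S = S} f f-hom M = record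
  { Carrierᴹ = Carrierᴹ
  ; _≈ᴹ_     = _≈ᴹ_
  ; _+ᴹ_     = _+ᴹ_
  ; _*ₗ_     = λ a x → f a *ₗ x
  ; 0ᴹ       = 0ᴹ
  ; -ᴹ_      = -ᴹ_
  ; isLeftModule = record
    { isLeftSemimodule = record
      { +ᴹ-isCommutativeMonoid = +ᴹ-isCommutativeMonoid
      ; isPreleftSemimodule = record
        { *ₗ-cong      = λ a≈b x≈y → *ₗ-cong (f.⟦⟧-cong a≈b) x≈y
        ; *ₗ-zeroˡ     = λ x → ≈ᴹ-trans (*ₗ-congʳ f.0#-homo) (*ₗ-zeroˡ x)
        ; *ₗ-distribʳ  = λ x a b →
            ≈ᴹ-trans (*ₗ-congʳ (f.+-homo a b)) (*ₗ-distribʳ x (f a) (f b))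
        ; *ₗ-identityˡ = λ x → ≈ᴹ-trans (*ₗ-congʳ f.1#-homo) (*ₗ-identityˡ x)
        ; *ₗ-assoc     = λ a b x →
            ≈ᴹ-trans (*ₗ-congʳ (f.*-homo a b)) (*ₗ-assoc (f a) (f b) x)
        ; *ₗ-zeroʳ     = λ a → *ₗ-zeroʳ (f a)
        ; *ₗ-distribˡ  = λ a x y → *ₗ-distribˡ (f a) x y
        }
      }
    ; -ᴹ‿cong    = -ᴹ‿cong
    ; -ᴹ‿inverse = -ᴹ‿inverse
    }
  }
  where
  open LeftModule M
  module f = RingMorphisms.IsRingHomomorphism f-hom

------------------------------------------------------------------------
-- Linear algebra; used below only over fields

module LinearAlgebra {r ℓr m ℓm} {R : Ring r ℓr} (M : LeftModule R m ℓm) where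
  open Ring R using (Carrier; _≈_; 0#)
  open LeftModule M

  Scalar : Set r
  Scalar = Carrier

  V : Set m
  V = Carrierᴹ

  open RawMonoidDefs +ᴹ-rawMonoid public using (sum)

  linComb : ∀ {n} → Vector Scalar n → Vector V n → V
  linComb a v = sum (λ i → a i *ₗ v i)

  record IsSubspace {ℓ} (W : Pred V ℓ) : Set (r ⊔ m ⊔ ℓm ⊔ ℓ) where
    field
      resp      : W Respects _≈ᴹ_
      0∈        : 0ᴹ ∈ W
      +-closed  : ∀ {x y} → x ∈ W → y ∈ W → x +ᴹ y ∈ W
      *ₗ-closed : ∀ a {x} → x ∈ W → a *ₗ x ∈ W

  ZeroSubspace : Pred V ℓm
  ZeroSubspace x = x ≈ᴹ 0ᴹ

  Span : ∀ {n} → Vector V n → Pred V (r ⊔ ℓm)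
  Span v x = ∃[ a ] x ≈ᴹ linComb a v

  -- The sum of the subspaces W i over all i ∈ P: the vectors that are finite
  -- sums of elements of these subspaces.
  SumOf : ∀ {ι ℓ ℓ′} {I : Set ι} →
          Pred I ℓ → (I → Pred V ℓ′) → Pred V (ι ⊔ ℓ ⊔ ℓ′ ⊔ m ⊔ ℓm)
  SumOf {I = I} P W x =
    ∃[ N ] ∃₂ λ (i : Vector I N) (w : Vector V N) →
      (∀ j → i j ∈ P) × (∀ j → w j ∈ W (i j)) × x ≈ᴹ sum w

  LinearlyIndependent : ∀ {n} → Vector V n → Set (r ⊔ ℓr ⊔ ℓm)
  LinearlyIndependent v = ∀ a → linComb a v ≈ᴹ 0ᴹ → ∀ i → a i ≈ 0#

  record IsBasis {ℓ n} (W : Pred V ℓ) (v : Vector V n)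
                 : Set (r ⊔ ℓr ⊔ m ⊔ ℓm ⊔ ℓ) where
    field
      contained   : ∀ i → v i ∈ W
      independent : LinearlyIndependent v
      spanning    : W ⊆ Span v

    coords : ∀ {x} → x ∈ W → Vector Scalar n
    coords x∈W = proj₁ (spanning x∈W)

  HasDim : ∀ {ℓ} → Pred V ℓ → ℕ → Set (r ⊔ ℓr ⊔ m ⊔ ℓm ⊔ ℓ)
  HasDim W n = ∃[ v ] IsBasis {n = n} W v

------------------------------------------------------------------------
-- Finite fields

-- On a finite carrier equality is decidable, so the apartness of a Heyting
-- field is forced to be inequality: these are the usual finite fields.
record FiniteField (q : ℕ) c ℓ₁ ℓ₂ : Set (suc (c ⊔ ℓ₁ ⊔ ℓ₂)) where
  field
    heytingField : HeytingField c ℓ₁ ℓ₂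

  commutativeRing : CommutativeRing c ℓ₁
  commutativeRing = HeytingCommutativeRing.commutativeRing
    (HeytingField.heytingCommutativeRing heytingField)

  open CommutativeRing commutativeRing public

  field
    enumeration : Inverse (≡.setoid (Fin q)) setoid

record FiniteFieldExtension (q m : ℕ) c ℓ₁ ℓ₂ c′ ℓ₁′ ℓ₂′
       : Set (suc (c ⊔ ℓ₁ ⊔ ℓ₂ ⊔ c′ ⊔ ℓ₁′ ⊔ ℓ₂′)) where
  field
    𝔽q  : FiniteField q c ℓ₁ ℓ₂
    𝔽qᵐ : FiniteField (q ^ m) c′ ℓ₁′ ℓ₂′

  module K = FiniteField 𝔽q
  module L = FiniteField 𝔽qᵐ

  field
    embed   : K.Carrier → L.Carrier
    isEmbed : RingMorphisms.IsRingMonomorphism K.rawRing L.rawRing embed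

  𝔽qᵐ-over-𝔽q : LeftModule K.ring c′ ℓ₁′
  𝔽qᵐ-over-𝔽q = restrictScalars {R = K.ring} {S = L.ring} embed
    (RingMorphisms.IsRingMonomorphism.isRingHomomorphism isEmbed)
    TensorUnit.leftModule

  𝔽q^_ : ℕ → LeftModule K.ring c ℓ₁
  𝔽q^ n = power TensorUnit.leftModule n

  𝔽qᵐ^_ : ℕ → LeftModule L.ring c′ ℓ₁′
  𝔽qᵐ^ n = power TensorUnit.leftModule n

  record FieldBasis : Set (c ⊔ ℓ₁ ⊔ c′ ⊔ ℓ₁′) where
    open LinearAlgebra 𝔽qᵐ-over-𝔽q using (IsBasis)
    field
      basis   : Vector L.Carrier m
      isBasis : IsBasis U basis

    coordinates : L.Carrier → Vector K.Carrier m
    coordinates x = IsBasis.coords isBasis {x} tt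

------------------------------------------------------------------------
-- Rank-metric codes of length n

module RankMetric
  {q m c ℓ₁ ℓ₂ c′ ℓ₁′ ℓ₂′}
  (E : FiniteFieldExtension q m c ℓ₁ ℓ₂ c′ ℓ₁′ ℓ₂′)
  (Γ : FiniteFieldExtension.FieldBasis E)
  (n : ℕ)
  where

  open FiniteFieldExtension E
  open FieldBasis Γ

  private
    module Kⁿ = LinearAlgebra (𝔽q^ n)
    module Lⁿ = LinearAlgebra (𝔽qᵐ^ n)

  Word : Set c′
  Word = Lⁿ.V

  -- Row i of the matrix; its j-th column is the coordinate vector of x j.
  Mat : Word → Vector (Vector K.Carrier n) m
  Mat x i j = coordinates (x j) i

  Support : Word → Pred Kⁿ.V (c ⊔ ℓ₁)
  Support x = Kⁿ.Span (Mat x)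

  HasRank : Word → ℕ → Set (c ⊔ ℓ₁)
  HasRank x = Kⁿ.HasDim (Support x)

  Nonzero : ∀ {ℓ} → Pred Word ℓ → Pred Word (ℓ ⊔ ℓ₁′)
  Nonzero C = C ∖ Lⁿ.ZeroSubspace

  record IsCode {ℓ} (C : Pred Word ℓ) (k d : ℕ)
                : Set (c ⊔ ℓ₁ ⊔ c′ ⊔ ℓ₁′ ⊔ ℓ) where
    field
      isSubspace      : Lⁿ.IsSubspace C
      dimension       : Lⁿ.HasDim C k
      dimension-pos   : 1 ≤ k
      minimumDistance :
        IsMinimum (λ r → ∃[ x ] x ∈ Nonzero C × HasRank x r) d

  Nondegenerate : ∀ {ℓ} → Pred Word ℓ → Set (c ⊔ ℓ₁ ⊔ c′ ⊔ ℓ)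
  Nondegenerate C = Kⁿ.SumOf C Support ≐ U

  Intersecting : ∀ {ℓ} → Pred Word ℓ → Set (c ⊔ ℓ₁ ⊔ c′ ⊔ ℓ₁′ ⊔ ℓ)
  Intersecting C = ∀ {x y} → x ∈ Nonzero C → y ∈ Nonzero C →
    ¬ (Support x ∩ Support y ≐ Kⁿ.ZeroSubspace)

{-# OPTIONS --safe #-}

-- The span of d vectors in Kⁿ has d pivot coordinates, meaning that a vector of
-- the span vanishing at all of them is zero; on the other hand, every subspace
-- of dimension more than d contains a nonzero vector vanishing at d given
-- coordinates.
--
-- The pivots of the m rows of the matrix of a minimum weight codeword x show
-- that d ≤ m. If d < k, then some nonzero codeword y vanishes at the d pivots
-- of σ(x). So does all of σ(y), whence σ(x) ∩ σ(y) = 0, a contradiction.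
module Submission where

open import Defs
open import Algebra.Apartness.Bundles using (HeytingField; HeytingCommutativeRing)
import Algebra.Apartness.Properties.HeytingCommutativeRing as HeytingProperties
open import Algebra.Bundles using (CommutativeMonoid; CommutativeRing; Ring)
open import Algebra.Module.Bundles using (LeftModule)
import Algebra.Module.Construct.TensorUnit as TensorUnit
import Algebra.Properties.CommutativeSemigroup as CommutativeSemigroupProperties
open import Data.Fin.Base using (Fin; zero; suc; fromℕ<; punchIn; punchOut)
import Data.Fin.Properties as Fin
open import Data.Nat.Base using (ℕ; zero; suc; _≤_; _<_; s≤s⁻¹)
open import Data.Nat.Properties using (≮⇒≥)
open import Data.Product.Base using (∃-syntax; _×_; _,_; proj₁; proj₂)
open import Data.Sum.Base using (_⊎_; inj₁; inj₂)
open import Data.Unit.Base using (tt)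
open import Data.Vec.Functional using (Vector; _∷_)
open import Function.Base using (_∘_)
open import Function.Construct.Symmetry using (inverse)
open import Function.Properties.Inverse using (Inverse⇒Injection)
open import Level using (Level)
open import Relation.Binary.Definitions using (Decidable)
open import Relation.Binary.PropositionalEquality using (subst)
import Relation.Binary.Reasoning.Setoid as ≈-Reasoning
open import Relation.Nullary.Decidable using (yes; no; via-injection; ¬?; decidable-stable)
open import Relation.Nullary.Negation using (¬_; contradiction)
open import Relation.Unary using (Pred; _∈_)

-- Linear combinations and spans in a module

module _ {r ℓr m ℓm} {R : Ring r ℓr} (M : LeftModule R m ℓm) where
  open Ring R using (_+_; _*_; 0#)
  open LeftModule M
  open LinearAlgebra M
  open ≈-Reasoning ≈ᴹ-setoid
  open CommutativeSemigroupProperties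
    (CommutativeMonoid.commutativeSemigroup +ᴹ-commutativeMonoid) using (interchange)

  linComb-zeroˡ : ∀ {k} (v : Vector V k) → linComb (λ _ → 0#) v ≈ᴹ 0ᴹ
  linComb-zeroˡ {zero}  v = ≈ᴹ-refl
  linComb-zeroˡ {suc k} v = ≈ᴹ-trans
    (+ᴹ-cong (*ₗ-zeroˡ (v zero)) (linComb-zeroˡ (v ∘ suc))) (+ᴹ-identityˡ 0ᴹ)

  linComb-distribʳ : ∀ {k} (a b : Vector Scalar k) (v : Vector V k) →
    linComb (λ i → a i + b i) v ≈ᴹ linComb a v +ᴹ linComb b v
  linComb-distribʳ {zero}  a b v = ≈ᴹ-sym (+ᴹ-identityˡ 0ᴹ)
  linComb-distribʳ {suc k} a b v = ≈ᴹ-trans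
    (+ᴹ-cong (*ₗ-distribʳ (v zero) (a zero) (b zero))
             (linComb-distribʳ (a ∘ suc) (b ∘ suc) (v ∘ suc)))
    (interchange _ _ _ _)

  linComb-assoc : ∀ {k} b (a : Vector Scalar k) (v : Vector V k) →
    linComb (λ i → b * a i) v ≈ᴹ b *ₗ linComb a v
  linComb-assoc {zero}  b a v = ≈ᴹ-sym (*ₗ-zeroʳ b)
  linComb-assoc {suc k} b a v = ≈ᴹ-trans
    (+ᴹ-cong (*ₗ-assoc b (a zero) (v zero)) (linComb-assoc b (a ∘ suc) (v ∘ suc)))
    (≈ᴹ-sym (*ₗ-distribˡ b _ _))

  Span-isSubspace : ∀ {k} (v : Vector V k) → IsSubspace (Span v)
  Span-isSubspace v = record
    { resp      = λ { x≈y (a , x≈) → a , ≈ᴹ-trans (≈ᴹ-sym x≈y) x≈ }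
    ; 0∈        = _ , ≈ᴹ-sym (linComb-zeroˡ v)
    ; +-closed  = λ { (a , x≈) (b , y≈) →
        _ , ≈ᴹ-trans (+ᴹ-cong x≈ y≈) (≈ᴹ-sym (linComb-distribʳ a b v)) }
    ; *ₗ-closed = λ { b (a , x≈) →
        _ , ≈ᴹ-trans (*ₗ-congˡ x≈) (≈ᴹ-sym (linComb-assoc b a v)) }
    }

  linComb-closed : ∀ {ℓ} {W : Pred V ℓ} → IsSubspace W → ∀ {k} (a : Vector Scalar k)
    {v : Vector V k} → (∀ i → v i ∈ W) → linComb a v ∈ W
  linComb-closed W {zero}  a v∈ = IsSubspace.0∈ W
  linComb-closed W {suc k} a v∈ = IsSubspace.+-closed W
    (IsSubspace.*ₗ-closed W (a zero) (v∈ zero))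
    (linComb-closed W (a ∘ suc) (v∈ ∘ suc))

-- Gaussian elimination over a field with decidable equality

module Pivots {c ℓ₁ ℓ₂} (F : HeytingField c ℓ₁ ℓ₂)
              (_≟_ : Decidable (HeytingField._≈_ F)) (n : ℕ) where
  private
    heytingCommutativeRing = HeytingField.heytingCommutativeRing F
    commutativeRing = HeytingCommutativeRing.commutativeRing heytingCommutativeRing

  open CommutativeRing commutativeRing hiding (zero)
  open HeytingProperties heytingCommutativeRing using (1#0; x#0y#0→xy#0)

  private
    Fⁿ = power {R = ring} TensorUnit.leftModule n

  open LinearAlgebra Fⁿ
  open LeftModule Fⁿ
    using (_≈ᴹ_; 0ᴹ; ≈ᴹ-trans; ≈ᴹ-sym)
  open ≈-Reasoning setoid
  open CommutativeSemigroupProperties +-commutativeSemigroup using (interchange)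
  open CommutativeSemigroupProperties *-commutativeSemigroup using (x∙yz≈y∙xz)

  1≉0 : ¬ 1# ≈ 0#
  1≉0 1≈0 = proj₂ (HeytingField.tight F 1# 0#) 1≈0 1#0

  -- By tightness it suffices to refute `y # 0#`, and then `x # 0#`: a product of elements apart
  -- from zero is apart from zero.
  xy≈0⇒y≈0 : ∀ {x y} → ¬ x ≈ 0# → x * y ≈ 0# → y ≈ 0#
  xy≈0⇒y≈0 {x} {y} x≉0 xy≈0 = proj₁ (HeytingField.tight F y 0#) λ y#0 →
    x≉0 (proj₁ (HeytingField.tight F x 0#) λ x#0 →
      proj₂ (HeytingField.tight F (x * y) 0#) xy≈0 (x#0y#0→xy#0 x#0 y#0))

  VanishesAt : ∀ {e} → Vector (Fin n) e → V → Set ℓ₁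
  VanishesAt s x = ∀ t → x (s t) ≈ 0#

  vanishes⊎pivot : ∀ {e} (s : Vector (Fin n) e) (x : V) →
    VanishesAt s x ⊎ (∃[ t ] ¬ x (s t) ≈ 0#)
  vanishes⊎pivot s x with Fin.any? (λ t → ¬? (x (s t) ≟ 0#))
  ... | yes pivot = inj₂ pivot
  ... | no  ∄     = inj₁ λ t → decidable-stable (x (s t) ≟ 0#) λ ≉0 → ∄ (t , ≉0)

  -- Fraction-free Gaussian elimination of coordinate p by means of u.
  eliminate : V → Fin n → V → V
  eliminate u p x j = u p * x j - x p * u j

  eliminate-pivot : ∀ u p x → eliminate u p x p ≈ 0#
  eliminate-pivot u p x = trans (+-congʳ (*-comm (u p) (x p))) (-‿inverseʳ _)

  linComb-vanishes : ∀ {k} (a : Vector Scalar k) (v : Vector V k) j →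
    (∀ i → v i j ≈ 0#) → linComb a v j ≈ 0#
  linComb-vanishes {zero}  a v j v≈0 = refl
  linComb-vanishes {suc k} a v j v≈0 = trans
    (+-cong (trans (*-congˡ (v≈0 zero)) (zeroʳ _))
            (linComb-vanishes (a ∘ suc) (v ∘ suc) j (v≈0 ∘ suc)))
    (+-identityˡ 0#)

  -- Linearity of `eliminate u p`, with the subtracted term moved to the left-hand side.
  linComb-eliminate : ∀ {k} u p (a : Vector Scalar k) (v : Vector V k) j →
    linComb a (eliminate u p ∘ v) j + linComb a v p * u j ≈ u p * linComb a v j
  linComb-eliminate {zero}  u p a v j = begin
    0# + 0# * u j  ≈⟨ +-identityˡ _ ⟩
    0# * u j       ≈⟨ zeroˡ _ ⟩
    0#             ≈⟨ zeroʳ _ ⟨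
    u p * 0#       ∎
  linComb-eliminate {suc k} u p a v j = begin
    (a₀ * x′ + S′) + (a₀ * x p + S p) * u j         ≈⟨ +-congˡ (distribʳ _ _ _) ⟩
    (a₀ * x′ + S′) + (a₀ * x p * u j + S p * u j)   ≈⟨ interchange _ _ _ _ ⟩
    (a₀ * x′ + a₀ * x p * u j) + (S′ + S p * u j)   ≈⟨ +-cong first (linComb-eliminate u p (a ∘ suc) (v ∘ suc) j) ⟩
    u p * (a₀ * x j) + u p * S j                    ≈⟨ distribˡ _ _ _ ⟨
    u p * (a₀ * x j + S j)                          ∎
    where
    a₀ = a zero
    x  = v zero
    x′ = eliminate u p x j
    S  = linComb (a ∘ suc) (v ∘ suc)
    S′ = linComb (a ∘ suc) (eliminate u p ∘ v ∘ suc) j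
    first : a₀ * x′ + a₀ * x p * u j ≈ u p * (a₀ * x j)
    first = begin
      a₀ * x′ + a₀ * x p * u j                            ≈⟨ +-congˡ (*-assoc _ _ _) ⟩
      a₀ * x′ + a₀ * (x p * u j)                          ≈⟨ distribˡ _ _ _ ⟨
      a₀ * (u p * x j - x p * u j + x p * u j)            ≈⟨ *-congˡ (+-assoc _ _ _) ⟩
      a₀ * (u p * x j + (- (x p * u j) + x p * u j))      ≈⟨ *-congˡ (+-congˡ (-‿inverseˡ _)) ⟩
      a₀ * (u p * x j + 0#)                               ≈⟨ *-congˡ (+-identityʳ _) ⟩
      a₀ * (u p * x j)                                    ≈⟨ x∙yz≈y∙xz _ _ _ ⟩
      u p * (a₀ * x j)                                    ∎

  -- A homogeneous system of `e` equations in `k > e` unknowns has a nontrivial solution. If the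
  -- first vector vanishes at `s`, it is a solution by itself; otherwise it serves to eliminate one
  -- equation and one unknown.
  vanishing-linComb : ∀ {e k} → e < k → (s : Vector (Fin n) e) (v : Vector V k) →
    ∃[ a ] (∃[ i ] ¬ a i ≈ 0#) × VanishesAt s (linComb a v)
  vanishing-linComb {e} {suc k} e<k s v with vanishes⊎pivot s (v zero)
  ... | inj₁ v₀≈0 = 1# ∷ (λ _ → 0#) , (zero , 1≉0) , λ t → begin
    1# * v zero (s t) + linComb (λ _ → 0#) (v ∘ suc) (s t)
      ≈⟨ +-cong (trans (*-identityˡ _) (v₀≈0 t)) (linComb-zeroˡ Fⁿ (v ∘ suc) (s t)) ⟩
    0# + 0#
      ≈⟨ +-identityˡ 0# ⟩
    0#
      ∎
  vanishing-linComb {suc e} {suc k} e<k s v | inj₂ (q , up≉0)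
    with b , (i , bᵢ≉0) , b-vanishes ← vanishing-linComb (s≤s⁻¹ e<k)
           (s ∘ punchIn q) (eliminate (v zero) (s q) ∘ v ∘ suc)
    -- These coefficients give `u p * S - S p * u`, the elimination of `S`, which is `S′`. Scaling
    -- by `u p ≉ 0` keeps `b i` nonzero.
    = (- S p) ∷ (λ j → u p * b j)
    , (suc i , bᵢ≉0 ∘ xy≈0⇒y≈0 up≉0)
    , λ t → begin
      - S p * u (s t) + linComb (λ j → u p * b j) (v ∘ suc) (s t)
        ≈⟨ +-congˡ (linComb-assoc Fⁿ (u p) b (v ∘ suc) (s t)) ⟩
      - S p * u (s t) + u p * S (s t)
        ≈⟨ +-congˡ (linComb-eliminate u p b (v ∘ suc) (s t)) ⟨
      - S p * u (s t) + (S′ (s t) + S p * u (s t))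
        ≈⟨ +-congˡ (trans (+-congʳ (S′-vanishes t)) (+-identityˡ _)) ⟩
      - S p * u (s t) + S p * u (s t)
        ≈⟨ distribʳ _ _ _ ⟨
      (- S p + S p) * u (s t)
        ≈⟨ trans (*-congʳ (-‿inverseˡ _)) (zeroˡ _) ⟩
      0#
        ∎
    where
    u  = v zero
    p  = s q
    S  = linComb b (v ∘ suc)
    S′ = linComb b (eliminate u p ∘ v ∘ suc)
    S′-vanishes : VanishesAt s S′
    -- Elimination clears the pivot coordinate; every other index lies in the image of `punchIn q`,
    -- where the recursion applies.
    S′-vanishes t with q Fin.≟ t
    ... | yes q≡t = subst (λ t → S′ (s t) ≈ 0#) q≡t
      (linComb-vanishes b _ p (eliminate-pivot u p ∘ v ∘ suc))
    ... | no  q≢t = subst (λ t → S′ (s t) ≈ 0#) (Fin.punchIn-punchOut q≢t)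
      (b-vanishes (punchOut q≢t))

  vanishing-vector : ∀ {ℓ} {W : Pred V ℓ} {e k} → IsSubspace W → HasDim W k → e < k →
    (s : Vector (Fin n) e) → ∃[ x ] x ∈ W × ¬ x ≈ᴹ 0ᴹ × VanishesAt s x
  vanishing-vector W (v , v-basis) e<k s
    with a , (i , aᵢ≉0) , vanishes ← vanishing-linComb e<k s v
    = linComb a v , linComb-closed Fⁿ W a contained
    , (λ x≈0 → aᵢ≉0 (independent a x≈0 i)) , vanishes
    where open IsBasis v-basis

  -- For a subspace `W`, this is injectivity on `W` of the projection to the coordinates `s`,
  -- expressed as a trivial kernel.
  Determines : ∀ {ℓ e} → Vector (Fin n) e → Pred V ℓ → Set _
  Determines s W = ∀ {x} → x ∈ W → VanishesAt s x → x ≈ᴹ 0ᴹ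

  -- Induction on `e`: a zero first vector is dropped, and a nonzero one is used to eliminate its
  -- pivot from the others. Quantifying over the coefficients `a` lets the recursive call reuse
  -- `a ∘ suc`.
  linComb-pivots : Fin n → ∀ {e} (v : Vector V e) →
    ∃[ s ] (∀ a → VanishesAt {e} s (linComb a v) → linComb a v ≈ᴹ 0ᴹ)
  linComb-pivots j₀ {zero}  v = (λ ()) , λ _ _ _ → refl
  linComb-pivots j₀ {suc e} v with vanishes⊎pivot (λ j → j) (v zero)
  ... | inj₁ v₀≈0 with s , determines ← linComb-pivots j₀ (v ∘ suc)
    = j₀ ∷ s
    , λ a vanishes → ≈ᴹ-trans (drop a)
        (determines (a ∘ suc) λ t → trans (sym (drop a (s t))) (vanishes (suc t)))
    where
    drop : ∀ a → linComb a v ≈ᴹ linComb (a ∘ suc) (v ∘ suc)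
    drop a j = trans (+-congʳ (trans (*-congˡ (v₀≈0 j)) (zeroʳ _))) (+-identityˡ _)
  linComb-pivots j₀ {suc e} v | inj₂ (p , up≉0)
    with s , determines ← linComb-pivots j₀ (eliminate (v zero) p ∘ v ∘ suc)
    = p ∷ s
    , λ a vanishes j → xy≈0⇒y≈0 up≉0 (trans (sym (scale a (vanishes zero) j))
        (determines (a ∘ suc) (λ t → begin
          linComb (a ∘ suc) (eliminate u p ∘ v ∘ suc) (s t)
            ≈⟨ scale a (vanishes zero) (s t) ⟩
          u p * linComb a v (s t)
            ≈⟨ *-congˡ (vanishes (suc t)) ⟩
          u p * 0#
            ≈⟨ zeroʳ _ ⟩
          0#
            ∎) j))
    where
    u = v zero
    -- Elimination sends `u` to zero, so `linComb a v` and its tail have the same elimination; for a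
    -- vector vanishing at `p`, eliminating amounts to multiplying by `u p`.
    scale : ∀ a → linComb a v p ≈ 0# → ∀ j →
      linComb (a ∘ suc) (eliminate u p ∘ v ∘ suc) j ≈ u p * linComb a v j
    scale a wp≈0 j = begin
      S′                                    ≈⟨ +-identityʳ _ ⟨
      S′ + 0#                               ≈⟨ +-congˡ (trans (*-congʳ wp≈0) (zeroˡ _)) ⟨
      S′ + (a₀ * u p + S p) * u j           ≈⟨ +-congˡ (trans (distribʳ _ _ _) (+-comm _ _)) ⟩
      S′ + (S p * u j + a₀ * u p * u j)     ≈⟨ +-assoc _ _ _ ⟨
      (S′ + S p * u j) + a₀ * u p * u j     ≈⟨ +-cong (linComb-eliminate u p (a ∘ suc) (v ∘ suc) j)
                                                 (trans (*-congʳ (*-comm _ _)) (*-assoc _ _ _)) ⟩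
      u p * S j + u p * (a₀ * u j)          ≈⟨ trans (+-comm _ _) (sym (distribˡ _ _ _)) ⟩
      u p * (a₀ * u j + S j)                ∎
      where
      a₀ = a zero
      S  = linComb (a ∘ suc) (v ∘ suc)
      S′ = linComb (a ∘ suc) (eliminate u p ∘ v ∘ suc) j

  -- The coordinate j₀ pads the pivots when the vectors are dependent.
  pivots : Fin n → ∀ {e} (v : Vector V e) → ∃[ s ] Determines {e = e} s (Span v)
  pivots j₀ v with s , determines ← linComb-pivots j₀ v
    = s , λ { (a , x≈) vanishes → ≈ᴹ-trans x≈
        (determines a λ t → trans (≈ᴹ-sym x≈ (s t)) (vanishes t)) }

-- Rank-metric codes over finite fields

module _ {q c ℓ₁ ℓ₂} (F : FiniteField q c ℓ₁ ℓ₂) where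
  open FiniteField F

  finiteField-≟ : Decidable _≈_
  finiteField-≟ = via-injection (Inverse⇒Injection (inverse enumeration)) Fin._≟_

theorem4p2 : ∀ {c ℓ₁ ℓ₂ c′ ℓ₁′ ℓ₂′ ℓ : Level} {q m n : ℕ} →
    IsPrimePower q → 1 ≤ m → 1 ≤ n →
    (E : FiniteFieldExtension q m c ℓ₁ ℓ₂ c′ ℓ₁′ ℓ₂′) →
    (Γ : FiniteFieldExtension.FieldBasis E) →
    let open RankMetric E Γ n in
    (C : Pred Word ℓ) {k d : ℕ} →
    IsCode C k d → Nondegenerate C → Intersecting C →
    k ≤ d × d ≤ m
theorem4p2 {n = n} _ _ 1≤n E Γ C {k} {d} code _ intersecting =
  minimum (proj₁ minimumDistance)
  where
  open FiniteFieldExtension E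
  open FieldBasis Γ
  open RankMetric E Γ n
  open IsCode code
  module KPivots = Pivots (FiniteField.heytingField 𝔽q) (finiteField-≟ 𝔽q) n
  module LPivots = Pivots (FiniteField.heytingField 𝔽qᵐ) (finiteField-≟ 𝔽qᵐ) n
  module Γ = LinearAlgebra.IsBasis isBasis

  j₀ : Fin n
  j₀ = fromℕ< 1≤n

  Support-isSubspace : ∀ x → LinearAlgebra.IsSubspace (𝔽q^ n) (Support x)
  Support-isSubspace x = Span-isSubspace (𝔽q^ n) (Mat x)

  -- The coordinates of a zero element form a linear relation among the basis vectors.
  coordinates-zero : ∀ {x} → x L.≈ L.0# → ∀ i → coordinates x i K.≈ K.0#
  coordinates-zero {x} x≈0 =
    Γ.independent (coordinates x) (L.trans (L.sym (proj₂ (Γ.spanning {x} tt))) x≈0)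

  -- A zero entry of `x` gives a zero column of `Mat x`, hence a zero entry in every combination of
  -- its rows.
  Support-vanishes : ∀ {e} {s : Vector (Fin n) e} {x w} →
    LPivots.VanishesAt s x → w ∈ Support x → KPivots.VanishesAt s w
  Support-vanishes {s = s} {x} vanishes (a , w≈) t = K.trans (w≈ (s t))
    (KPivots.linComb-vanishes a (Mat x) (s t) (coordinates-zero (vanishes t)))

  minimum : ∃[ x ] x ∈ Nonzero C × HasRank x d → k ≤ d × d ≤ _
  minimum (x , x∈ , rank@(v , v-basis)) = ≮⇒≥ d≮k , ≮⇒≥ m≮d
    where
    d≮k : ¬ d < k
    d≮k d<k
      -- The basis `v` of the support of `x` has `d` vectors, so it yields exactly `d` pivots, fewer
      -- than the dimension `k` of the code.
      with s , determines ← KPivots.pivots j₀ v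
      with y , y∈C , y≉0 , vanishes ← LPivots.vanishing-vector isSubspace dimension d<k s
      = intersecting x∈ (y∈C , y≉0)
        ( (λ { (w∈σx , w∈σy) → determines
               (LinearAlgebra.IsBasis.spanning v-basis w∈σx)
               (Support-vanishes {x = y} vanishes w∈σy) })
        , λ w≈0 → zero∈ x w≈0 , zero∈ y w≈0 )
      where
      zero∈ : ∀ z {w} → (∀ j → w j K.≈ K.0#) → w ∈ Support z
      zero∈ z w≈0 = resp (λ j → K.sym (w≈0 j)) 0∈
        where open LinearAlgebra.IsSubspace (Support-isSubspace z)

    m≮d : ¬ _ < d
    m≮d m<d
      -- Here the pivots come from the `m` rows, which span the same support; a dimension above `m`
      -- would leave a nonzero vector vanishing at all of them.
      with s , determines ← KPivots.pivots j₀ (Mat x)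
      with w , w∈σx , w≉0 , vanishes ←
             KPivots.vanishing-vector (Support-isSubspace x) rank m<d s
      = w≉0 (determines w∈σx vanishes)
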